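{- For every integer $k\geq 2$, the graph $H_{2k-2}$ satisfies $w(H_{2k-2})=2k$, $2|L_e(H_{2k-2})|+2=\ell_e(H_{2k-2})=2k+2$, and $\chi(H_{2k-2})=2k+1=2|L_e(H_{2k-2})|+1=\ell_e(H_{2k-2})-1$. In particular $w(H_{2k-2})=2|L_e(H_{2k-2})|$ but $\chi(H_{2k-2})=2|L_e(H_{2k-2})|+1$.
   Context: For an integer $i\geq 1$, $H_i$ denotes the graph obtained from the disjoint union of the complete graph $K_i$ and the 5-cycle $C_5$ by adding all edges between $K_i$ and $C_5$. $L_e(G)$ denotes the set of all even integers $m$ such that $G$ contains a cycle of length $m$, and $\ell_e(G)$ the length of a longest even cycle of $G$. $w(G)$ denotes the clique number (the number of vertices of a largest clique) and $\chi(G)$ the chromatic number. -}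

module Defs where

open import Data.Empty using (⊥)
open import Data.Fin.Base using (Fin; toℕ)
open import Data.List.Base using (List; length)
open import Data.List.Membership.Propositional using (_∈_)
open import Data.List.Relation.Unary.Unique.Propositional using (Unique)
open import Data.Nat.Base using (ℕ; suc; _≤_; z≤n; s≤s)
open import Data.Nat.Divisibility using (_∣_)
open import Data.Nat.Properties using (1+n≢n)
open import Data.Product.Base using (Σ; ∃; _×_; _,_)
open import Data.Sum.Base using (_⊎_; inj₁; inj₂; swap)
open import Data.Unit.Base using (⊤; tt)
open import Function.Bundles using (_⇔_)
open import Function.Definitions using (Injective)
open import Relation.Binary.Core using (Rel)
open import Relation.Binary.Definitions using (Symmetric; Irreflexive)
open import Relation.Binary.PropositionalEquality
  using (_≡_; _≢_; refl; sym; trans; cong; subst; ≢-sym)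
open import Relation.Nullary.Negation using (¬_)
open import Relation.Unary using (Pred)
open import Level using (0ℓ)

record Graph : Set₁ where
  field
    Vertex : Set
    Adj    : Rel Vertex 0ℓ
    adj-sym    : Symmetric Adj
    adj-irrefl : Irreflexive _≡_ Adj

open Graph public

K : ℕ → Graph
K n = record
  { Vertex     = Fin n
  ; Adj        = _≢_
  ; adj-sym    = ≢-sym
  ; adj-irrefl = λ i≡j i≢j → i≢j i≡j
  }

-- j follows i in the cyclic order 0, 1, …, n-1, 0.
Next : ∀ n → Rel (Fin n) 0ℓ
Next n i j = toℕ j ≡ suc (toℕ i) ⊎ (suc (toℕ i) ≡ n × toℕ j ≡ 0)

private
  next-irrefl : ∀ {n} → 3 ≤ n → ∀ i → ¬ Next n i i
  next-irrefl _   i (inj₁ i≡1+i)       = 1+n≢n (sym i≡1+i)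
  next-irrefl 3≤n i (inj₂ (1+i≡n , i≡0))
    with subst (3 ≤_) (trans (sym 1+i≡n) (cong suc i≡0)) 3≤n
  ... | s≤s ()

C : ∀ n → 3 ≤ n → Graph
C n 3≤n = record
  { Vertex     = Fin n
  ; Adj        = λ i j → Next n i j ⊎ Next n j i
  ; adj-sym    = swap
  ; adj-irrefl = λ { {i} refl (inj₁ p) → next-irrefl 3≤n i p
                   ; {i} refl (inj₂ p) → next-irrefl 3≤n i p }
  }

-- Disjoint union of two graphs with all edges between them added.
join : Graph → Graph → Graph
join G G′ = record
  { Vertex     = Vertex G ⊎ Vertex G′
  ; Adj        = E
  ; adj-sym    = λ {x} {y} → E-sym x y
  ; adj-irrefl = λ { {x} refl → E-irrefl x }
  }
  where
  E : Rel (Vertex G ⊎ Vertex G′) 0ℓ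
  E (inj₁ u) (inj₁ v) = Adj G u v
  E (inj₁ _) (inj₂ _) = ⊤
  E (inj₂ _) (inj₁ _) = ⊤
  E (inj₂ u) (inj₂ v) = Adj G′ u v

  E-sym : ∀ x y → E x y → E y x
  E-sym (inj₁ _) (inj₁ _) = adj-sym G
  E-sym (inj₁ _) (inj₂ _) = λ _ → tt
  E-sym (inj₂ _) (inj₁ _) = λ _ → tt
  E-sym (inj₂ _) (inj₂ _) = adj-sym G′

  E-irrefl : ∀ x → E x x → ⊥
  E-irrefl (inj₁ _) = adj-irrefl G refl
  E-irrefl (inj₂ _) = adj-irrefl G′ refl

H : ℕ → Graph
H i = join (K i) (C 5 (s≤s (s≤s (s≤s z≤n))))

-- G′ is isomorphic to a (not necessarily induced) subgraph of G.
infix 4 _⊑_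
_⊑_ : Graph → Graph → Set
G′ ⊑ G = Σ (Vertex G′ → Vertex G) λ f →
  Injective _≡_ _≡_ f × (∀ {u v} → Adj G′ u v → Adj G (f u) (f v))

HasClique : Graph → Pred ℕ 0ℓ
HasClique G n = K n ⊑ G

HasCycle : Graph → Pred ℕ 0ℓ
HasCycle G m = Σ (3 ≤ m) λ 3≤m → C m 3≤m ⊑ G

Colourable : Graph → Pred ℕ 0ℓ
Colourable G n = Σ (Vertex G → Fin n) λ c → ∀ {u v} → Adj G u v → c u ≢ c v

Lₑ : Graph → Pred ℕ 0ℓ
Lₑ G m = 2 ∣ m × HasCycle G m

IsMaximum : Pred ℕ 0ℓ → Pred ℕ 0ℓ
IsMaximum P n = P n × (∀ m → P m → m ≤ n)

IsMinimum : Pred ℕ 0ℓ → Pred ℕ 0ℓ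
IsMinimum P n = P n × (∀ m → P m → n ≤ m)

-- The set { m | P m } has exactly n elements.  It is enumerated by a
-- duplicate-free list because Σ ℕ P would also count the proofs of P m.
HasCardinality : Pred ℕ 0ℓ → Pred ℕ 0ℓ
HasCardinality P n = ∃ λ (xs : List ℕ) →
  Unique xs × (∀ m → m ∈ xs ⇔ P m) × length xs ≡ n

-- The invariants are stated as relations; each relation below holds of
-- at most one number.

IsCliqueNumber : Graph → Pred ℕ 0ℓ
IsCliqueNumber G = IsMaximum (HasClique G)

IsChromaticNumber : Graph → Pred ℕ 0ℓ
IsChromaticNumber G = IsMinimum (Colourable G)

IsLongestEvenCycleLength : Graph → Pred ℕ 0ℓ
IsLongestEvenCycleLength G = IsMaximum (Lₑ G)

{-# OPTIONS --safe #-}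
-- Adding one dominating vertex to a graph raises both the clique number and
-- the chromatic number by exactly one, so H i has clique number i + 2 and
-- chromatic number i + 3.  As soon as i ≥ 1, H i has cycles of all lengths from
-- 3 up to its order i + 5: traverse a path of C₅ and return through Kᵢ.
-- With i = 2k - 2 the even ones among them are 4, 6, …, 2k + 2.
module Submission where

open import Defs
open import Data.Nat.Base
  using (ℕ; zero; suc; _+_; _*_; _∸_; _≤_; _<_; z≤n; s≤s; s≤s⁻¹; z<s)
import Data.Nat.Properties as ℕ
open import Data.Nat.Divisibility using (divides)
open import Data.Fin.Base as Fin
  using (Fin; toℕ; splitAt; inject≤; punchIn; punchOut; _↑ʳ_)
open import Data.Fin.Patterns using (0F; 1F; 2F; 3F; 4F)
open import Data.Fin.Properties as Fin using (all?; any?)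
open import Data.List.Base using (applyUpTo)
open import Data.List.Membership.Propositional using (_∈_)
open import Data.List.Membership.Propositional.Properties
  using (∈-applyUpTo⁺; ∈-applyUpTo⁻)
open import Data.List.Properties using (length-applyUpTo)
open import Data.List.Relation.Unary.Unique.Propositional.Properties
  using (applyUpTo⁺₁)
open import Data.Product.Base using (∃-syntax; _×_; _,_; proj₁)
open import Data.Sum.Base as Sum using (_⊎_; inj₁; inj₂)
open import Data.Sum.Properties using (inj₁-injective; inj₂-injective)
open import Data.Unit.Base using (tt)
open import Function.Base using (_∘_; id)
open import Function.Bundles using (mk⇔; module Injection)
open import Function.Definitions using (Injective)
open import Function.Properties.Inverse using (↔⇒↣; ↔-sym)
open import Relation.Binary.PropositionalEquality
  using (_≡_; _≢_; refl; sym; trans; cong; subst; subst₂; ≢-sym; module ≡-Reasoning)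
open import Relation.Nullary.Decidable
  using (Dec; yes; no; from-yes; ¬?; decidable-stable; _⊎-dec_; _×-dec_; _→-dec_)
open import Relation.Nullary.Negation using (¬_; contradiction)

private
  variable
    i k m n : ℕ
    G G′ : Graph

-- Injections and subgraph embeddings

map-injective : {A B A′ B′ : Set} {f : A → A′} {g : B → B′} →
                Injective _≡_ _≡_ f → Injective _≡_ _≡_ g →
                Injective _≡_ _≡_ (Sum.map f g)
map-injective f-inj g-inj {inj₁ _} {inj₁ _} eq = cong inj₁ (f-inj (inj₁-injective eq))
map-injective f-inj g-inj {inj₂ _} {inj₂ _} eq = cong inj₂ (g-inj (inj₂-injective eq))

splitAt-injective : ∀ m → Injective _≡_ _≡_ (splitAt m {n})
splitAt-injective m = Injection.injective (↔⇒↣ (Fin.+↔⊎ {m}))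

⊑-trans : ∀ {G₁ G₂ G₃} → G₁ ⊑ G₂ → G₂ ⊑ G₃ → G₁ ⊑ G₃
⊑-trans (f , f-inj , f-adj) (g , g-inj , g-adj) =
  g ∘ f , f-inj ∘ g-inj , g-adj ∘ f-adj

K⊑K : m ≤ n → K m ⊑ K n
K⊑K m≤n = f , f-inj , (_∘ f-inj)
  where
  f = λ u → inject≤ u m≤n
  f-inj : Injective _≡_ _≡_ f
  f-inj = Fin.inject≤-injective m≤n m≤n _ _

-- Injectivity is automatic: non-adjacency of a vertex to itself separates images.
mkClique : (f : Fin n → Vertex G) → (∀ {u v} → u ≢ v → Adj G (f u) (f v)) →
           HasClique G n
mkClique {G = G} f f-adj = f , f-inj , f-adj
  where
  f-inj : Injective _≡_ _≡_ f
  f-inj {u} {v} fu≡fv = decidable-stable (u Fin.≟ v)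
    λ u≢v → adj-irrefl G fu≡fv (f-adj u≢v)

-- Cliques in joins

join-clique : HasClique G m → HasClique G′ n → HasClique (join G G′) (m + n)
join-clique {G} {m} {G′} {n} (f , _ , f-adj) (g , _ , g-adj) =
  mkClique {G = join G G′} (Sum.map f g ∘ splitAt m)
    λ u≢v → adj (splitAt m _) (splitAt m _) (u≢v ∘ splitAt-injective m)
  where
  adj : ∀ x y → x ≢ y → Adj (join G G′) (Sum.map f g x) (Sum.map f g y)
  adj (inj₁ _) (inj₁ _) x≢y = f-adj (x≢y ∘ cong inj₁)
  adj (inj₁ _) (inj₂ _) _   = tt
  adj (inj₂ _) (inj₁ _) _   = tt
  adj (inj₂ _) (inj₂ _) x≢y = g-adj (x≢y ∘ cong inj₂)

module _ {i : ℕ} {G : Graph} where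

  private
    J J⁺ : Graph
    J  = join (K i) G
    J⁺ = join (K (suc i)) G

    apex : Vertex J⁺
    apex = inj₁ 0F

  -- The constructors alone settle this, even when equality of vertices of `G` is undecidable.
  isApex? : (x : Vertex J⁺) → Dec (x ≡ apex)
  isApex? (inj₁ 0F)          = yes refl
  isApex? (inj₁ (Fin.suc _)) = no λ ()
  isApex? (inj₂ _)           = no λ ()

  lower : (x : Vertex J⁺) → x ≢ apex → Vertex J
  lower (inj₁ 0F)          x≢a = contradiction refl x≢a
  lower (inj₁ (Fin.suc a)) _   = inj₁ a
  lower (inj₂ v)           _   = inj₂ v

  lower-adj : ∀ x y (x≢a : x ≢ apex) (y≢a : y ≢ apex) →
              Adj J⁺ x y → Adj J (lower x x≢a) (lower y y≢a)
  lower-adj (inj₁ 0F)          _                  x≢a _   _ = contradiction refl x≢a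
  lower-adj (inj₁ (Fin.suc _)) (inj₁ 0F)          _   y≢a _ = contradiction refl y≢a
  lower-adj (inj₂ _)           (inj₁ 0F)          _   y≢a _ = contradiction refl y≢a
  lower-adj (inj₁ (Fin.suc _)) (inj₁ (Fin.suc _)) _ _ a≢b = a≢b ∘ cong Fin.suc
  lower-adj (inj₁ (Fin.suc _)) (inj₂ _)           _ _ _   = tt
  lower-adj (inj₂ _)           (inj₁ (Fin.suc _)) _ _ _   = tt
  lower-adj (inj₂ _)           (inj₂ _)           _ _ adj = adj

  -- By injectivity at most one vertex of the clique lands on the apex. Discard that one; the rest
  -- lies in `J`.
  join-suc-clique⁻ : HasClique J⁺ (suc m) → HasClique J m
  join-suc-clique⁻ {m} (f , f-inj , f-adj) = delete avoid
    where
    delete : (∃[ j ] ∀ u → u ≢ j → f u ≢ apex) → HasClique J m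
    delete (j , f≢a) = mkClique {G = J}
      (λ u → lower (g u) (g≢a u))
      (λ {u} {v} u≢v → lower-adj (g u) (g v) (g≢a u) (g≢a v)
        (f-adj (u≢v ∘ Fin.punchIn-injective j u v)))
      where
      g : Fin m → Vertex J⁺
      g = f ∘ punchIn j

      g≢a : ∀ u → g u ≢ apex
      g≢a u = f≢a (punchIn j u) (Fin.punchInᵢ≢i j u)

    avoid : ∃[ j ] ∀ u → u ≢ j → f u ≢ apex
    avoid with any? (isApex? ∘ f)
    ... | yes (j , fj≡a) = j , λ u u≢j fu≡a → u≢j (f-inj (trans fu≡a (sym fj≡a)))
    -- The clique misses the apex, so any vertex may be discarded.
    ... | no  ∄apex      = 0F , λ u _ fu≡a → ∄apex (u , fu≡a)

  -- The apex is adjacent to every other vertex, so its colour occurs nowhere else and `punchOut`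
  -- can remove it from the palette.
  join-suc-colourable⁻ : Colourable J⁺ (suc n) → Colourable J n
  join-suc-colourable⁻ (c , c-proper) =
    (λ x → punchOut (apart x)) ,
    λ {x} {y} xy → c-proper (raise-adj x y xy) ∘
      Fin.punchOut-injective (apart x) (apart y)
    where
    raise : Vertex J → Vertex J⁺
    raise = Sum.map Fin.suc id

    apart : ∀ x → c apex ≢ c (raise x)
    apart (inj₁ _) = c-proper λ ()
    apart (inj₂ _) = c-proper tt

    raise-adj : ∀ x y → Adj J x y → Adj J⁺ (raise x) (raise y)
    raise-adj (inj₁ _) (inj₁ _) a≢b = a≢b ∘ Fin.suc-injective
    raise-adj (inj₁ _) (inj₂ _) _   = tt
    raise-adj (inj₂ _) (inj₁ _) _   = tt
    raise-adj (inj₂ _) (inj₂ _) adj = adj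

-- Induction on `i`, removing one apex at a time until only `G` is left.
join-K-clique-≤ : (∀ m → HasClique G m → m ≤ n) →
                  ∀ i m → HasClique (join (K i) G) m → m ≤ i + n
join-K-clique-≤ {G} bound zero m (f , f-inj , f-adj) =
  bound m (mkClique {G = G} (drop ∘ f) λ u≢v → drop-adj (f _) (f _) (f-adj u≢v))
  where
  drop : Fin 0 ⊎ Vertex G → Vertex G
  drop (inj₂ v) = v

  drop-adj : ∀ x y → Adj (join (K 0) G) x y → Adj G (drop x) (drop y)
  drop-adj (inj₂ _) (inj₂ _) adj = adj
join-K-clique-≤ bound (suc i) zero    _ = z≤n
join-K-clique-≤ bound (suc i) (suc m) Q =
  s≤s (join-K-clique-≤ bound i m (join-suc-clique⁻ Q))

-- Colourings of joins

-- The two sides get disjoint palettes, which takes care of all the edges between them.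
join-colourable : Colourable G m → Colourable G′ n → Colourable (join G G′) (m + n)
join-colourable {G} {m} {G′} {n} (c , c-proper) (c′ , c′-proper) =
  Fin.join m n ∘ Sum.map c c′ ,
  λ {x} {y} xy → proper x y xy ∘ Injection.injective (↔⇒↣ (↔-sym Fin.+↔⊎))
  where
  proper : ∀ x y → Adj (join G G′) x y → Sum.map c c′ x ≢ Sum.map c c′ y
  proper (inj₁ _) (inj₁ _) adj = c-proper adj ∘ inj₁-injective
  proper (inj₁ _) (inj₂ _) _   = λ ()
  proper (inj₂ _) (inj₁ _) _   = λ ()
  proper (inj₂ _) (inj₂ _) adj = c′-proper adj ∘ inj₂-injective

join-K-colourable-≥ : (∀ n → Colourable G n → m ≤ n) →
                      ∀ i n → Colourable (join (K i) G) n → i + m ≤ n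
join-K-colourable-≥ bound zero n (c , c-proper) = bound n (c ∘ inj₂ , c-proper)
join-K-colourable-≥ bound (suc i) zero (c , _) = contradiction (c (inj₁ 0F)) Fin.¬Fin0
join-K-colourable-≥ {G} bound (suc i) (suc n) col =
  s≤s (join-K-colourable-≥ {G} bound i n (join-suc-colourable⁻ {G = G} col))

-- Cycles in joins

-- The cycle runs through `a` vertices of `K i`, then along the path `0, 1, …, b - 1` of `C n`;
-- passing from one side to the other is always allowed.
arc-⊑-join : ∀ {a b i n} (3≤a+b : 3 ≤ a + b) (3≤n : 3 ≤ n) →
             1 ≤ a → a ≤ i → b ≤ n →
             C (a + b) 3≤a+b ⊑ join (K i) (C n 3≤n)
arc-⊑-join {a} {b} {i} {n} 3≤a+b 3≤n 1≤a a≤i b≤n =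
  f , f-inj , λ { (inj₁ p) → next p
                ; {u} {v} (inj₂ p) → adj-sym J {f v} {f u} (next p) }
  where
  J : Graph
  J = join (K i) (C n 3≤n)

  place : Fin a ⊎ Fin b → Vertex J
  place = Sum.map (λ x → inject≤ x a≤i) (λ y → inject≤ y b≤n)

  f : Fin (a + b) → Vertex J
  f = place ∘ splitAt a

  f-inj : Injective _≡_ _≡_ f
  f-inj = splitAt-injective a ∘
    map-injective (Fin.inject≤-injective a≤i a≤i _ _)
                  (Fin.inject≤-injective b≤n b≤n _ _)

  -- The closing edge of the cycle starts in the C n part and, as a ≥ 1, ends in
  -- the K i part, so an edge inside the C n part is a step of the path 0, 1, ….
  next-right : ∀ {y y′} → Next (a + b) (a ↑ʳ y) (a ↑ʳ y′) → toℕ y′ ≡ suc (toℕ y)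
  next-right {y} {y′} (inj₁ eq) = ℕ.+-cancelˡ-≡ a _ _ (begin
    a + toℕ y′           ≡⟨ Fin.toℕ-↑ʳ a y′ ⟨
    toℕ (a ↑ʳ y′)        ≡⟨ eq ⟩
    suc (toℕ (a ↑ʳ y))   ≡⟨ cong suc (Fin.toℕ-↑ʳ a y) ⟩
    suc (a + toℕ y)      ≡⟨ ℕ.+-suc a (toℕ y) ⟨
    a + suc (toℕ y)      ∎)
    where open ≡-Reasoning
  next-right {y′ = y′} (inj₂ (_ , eq)) = contradiction
    (ℕ.m+n≡0⇒m≡0 a (trans (sym (Fin.toℕ-↑ʳ a y′)) eq))
    (≢-sym (ℕ.<⇒≢ 1≤a))

  place-adj : ∀ x x′ → Next (a + b) (Fin.join a b x) (Fin.join a b x′) →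
              x ≢ x′ → Adj J (place x) (place x′)
  place-adj (inj₁ _) (inj₁ _) _ x≢x′ =
    x≢x′ ∘ cong inj₁ ∘ Fin.inject≤-injective a≤i a≤i _ _
  place-adj (inj₁ _) (inj₂ _) _ _ = tt
  place-adj (inj₂ _) (inj₁ _) _ _ = tt
  place-adj (inj₂ y) (inj₂ y′) p _ = inj₁ (inj₁
    (trans (Fin.toℕ-inject≤ y′ b≤n)
      (trans (next-right p) (cong suc (sym (Fin.toℕ-inject≤ y b≤n))))))

  next : ∀ {u v} → Next (a + b) u v → Adj J (f u) (f v)
  next {u} {v} p = place-adj (splitAt a u) (splitAt a v)
    (subst₂ (Next (a + b)) (sym (Fin.join-splitAt a b u)) (sym (Fin.join-splitAt a b v)) p)
    -- Adjacency in `K i` is distinctness, which comes from irreflexivity of the source cycle.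
    (λ eq → adj-irrefl (C (a + b) 3≤a+b) (splitAt-injective a eq) (inj₁ p))

-- A single vertex of `K i` closes up a path of `m - 1` vertices when these fit into `C n`.
-- Otherwise the path takes all of `C n` and `K i` supplies the remaining `m - n` vertices.
join-K-C-pancyclic : (3≤n : 3 ≤ n) → 1 ≤ i → 3 ≤ m → m ≤ i + n →
                     HasCycle (join (K i) (C n 3≤n)) m
join-K-C-pancyclic {n} {i} {suc p} 3≤n 1≤i 3≤m m≤i+n with ℕ.≤-total p n
... | inj₁ p≤n = 3≤m , arc-⊑-join 3≤m 3≤n ℕ.≤-refl 1≤i p≤n
... | inj₂ n≤p
  with d , n+d≡p ← ℕ.m≤n⇒∃[o]m+o≡n n≤p
  -- With `p` in the form `d + n`, the length `suc p` computes to `suc d + n`, so `a = suc d` and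
  -- `b = n`.
  with refl ← trans (ℕ.+-comm d n) n+d≡p
  = 3≤m , arc-⊑-join 3≤m 3≤n z<s (ℕ.+-cancelʳ-≤ n (suc d) i m≤i+n) ℕ.≤-refl

join-K-C-cycle-≤ : (3≤n : 3 ≤ n) → HasCycle (join (K i) (C n 3≤n)) m → m ≤ i + n
join-K-C-cycle-≤ _ (_ , f , f-inj , _) =
  Fin.injective⇒≤ (f-inj ∘ Injection.injective (↔⇒↣ (↔-sym Fin.+↔⊎)))

-- The 5-cycle

3≤5 : 3 ≤ 5
3≤5 = s≤s (s≤s (s≤s z≤n))

C₅ : Graph
C₅ = C 5 3≤5

next? : ∀ n (u v : Fin n) → Dec (Next n u v)
next? n u v = toℕ v ℕ.≟ suc (toℕ u) ⊎-dec (suc (toℕ u) ℕ.≟ n ×-dec toℕ v ℕ.≟ 0)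

C₅-adj? : ∀ u v → Dec (Adj C₅ u v)
C₅-adj? u v = next? 5 u v ⊎-dec next? 5 v u

-- Decided by checking all triples of vertices.
C₅-triangle-free : ∀ u v w → Adj C₅ u v → Adj C₅ v w → ¬ Adj C₅ u w
C₅-triangle-free = from-yes (all? λ u → all? λ v → all? λ w →
  C₅-adj? u v →-dec (C₅-adj? v w →-dec ¬? (C₅-adj? u w)))

C₅-edge : HasClique C₅ 2
C₅-edge = mkClique {G = C₅} (λ u → inject≤ u (s≤s (s≤s z≤n))) adj
  where
  adj : {u v : Fin 2} → u ≢ v → Adj C₅ (inject≤ u _) (inject≤ v _)
  adj {0F} {0F} u≢v = contradiction refl u≢v
  adj {0F} {1F} _   = inj₁ (inj₁ refl)
  adj {1F} {0F} _   = inj₂ (inj₁ refl)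
  adj {1F} {1F} u≢v = contradiction refl u≢v

C₅-clique-≤ : ∀ m → HasClique C₅ m → m ≤ 2
C₅-clique-≤ m Q = ℕ.≮⇒≥ λ 3≤m →
  let f , _ , f-adj = ⊑-trans {K 3} {K m} {C₅} (K⊑K 3≤m) Q in
  C₅-triangle-free (f 0F) (f 1F) (f 2F) (f-adj λ ()) (f-adj λ ()) (f-adj λ ())

C₅-3-colourable : Colourable C₅ 3
C₅-3-colourable = c , λ {u} {v} → proper u v
  where
  c : Fin 5 → Fin 3
  c 0F = 0F
  c 1F = 1F
  c 2F = 0F
  c 3F = 1F
  c 4F = 2F

  proper : ∀ u v → Adj C₅ u v → c u ≢ c v
  proper = from-yes (all? λ u → all? λ v →
    C₅-adj? u v →-dec ¬? (c u Fin.≟ c v))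

Fin₂-≢-≢⇒≡ : {x y z : Fin 2} → x ≢ y → y ≢ z → x ≡ z
Fin₂-≢-≢⇒≡ {0F} {_}  {0F} _   _   = refl
Fin₂-≢-≢⇒≡ {1F} {_}  {1F} _   _   = refl
Fin₂-≢-≢⇒≡ {0F} {0F} {1F} x≢y _   = contradiction refl x≢y
Fin₂-≢-≢⇒≡ {0F} {1F} {1F} _   y≢z = contradiction refl y≢z
Fin₂-≢-≢⇒≡ {1F} {0F} {0F} _   y≢z = contradiction refl y≢z
Fin₂-≢-≢⇒≡ {1F} {1F} {0F} x≢y _   = contradiction refl x≢y

-- Odd cycle argument: with two colours, vertices two steps apart agree, so 0, 2 and 4 share a
-- colour although 4 and 0 are adjacent.
C₅-colourable-≥ : ∀ n → Colourable C₅ n → 3 ≤ n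
C₅-colourable-≥ n (c , c-proper) = ℕ.≮⇒≥ λ n<3 →
  let n≤2 = s≤s⁻¹ n<3
      d : Fin 5 → Fin 2
      d u = inject≤ (c u) n≤2
      step : ∀ {u v} → Adj C₅ u v → d u ≢ d v
      step uv = c-proper uv ∘ Fin.inject≤-injective n≤2 n≤2 _ _
      d₀≡d₂ : d 0F ≡ d 2F
      d₀≡d₂ = Fin₂-≢-≢⇒≡ (step (inj₁ (inj₁ refl))) (step (inj₁ (inj₁ refl)))
      d₂≡d₄ : d 2F ≡ d 4F
      d₂≡d₄ = Fin₂-≢-≢⇒≡ (step (inj₁ (inj₁ refl))) (step (inj₁ (inj₁ refl)))
  in step (inj₁ (inj₂ (refl , refl))) (sym (trans d₀≡d₂ d₂≡d₄))

-- Invariants of H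

H-cliqueNumber : ∀ i → IsCliqueNumber (H i) (i + 2)
H-cliqueNumber i =
  join-clique {K i} {i} {C₅} (id , id , id) C₅-edge ,
  join-K-clique-≤ {C₅} C₅-clique-≤ i

H-chromaticNumber : ∀ i → IsChromaticNumber (H i) (i + 3)
H-chromaticNumber i =
  join-colourable {K i} {i} {C₅} (id , id) C₅-3-colourable ,
  join-K-colourable-≥ {C₅} C₅-colourable-≥ i

-- The equation `i + 2 ≡ 2 * k` stands for `i = 2k - 2` and keeps truncated subtraction out of the
-- computations.
module _ (1≤i : 1 ≤ i) (i+2≡2k : i + 2 ≡ 2 * k) where

  open ℕ.≤-Reasoning

  -- The even lengths 4, 6, ..., 2k + 2 are indexed by `j < k`; the shift by 2 skips 0 and 2, which
  -- are too short for a cycle.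
  Lₑ-H⁺ : ∀ {j} → j < k → Lₑ (H i) ((2 + j) * 2)
  Lₑ-H⁺ {j} j<k = divides (2 + j) refl , join-K-C-pancyclic 3≤5 1≤i (s≤s (s≤s (s≤s z≤n))) (begin
    (2 + j) * 2    ≤⟨ ℕ.*-monoˡ-≤ 2 (s≤s j<k) ⟩
    suc k * 2      ≡⟨ cong (2 +_) (ℕ.*-comm k 2) ⟩
    2 + 2 * k      ≡⟨ cong (2 +_) i+2≡2k ⟨
    2 + (i + 2)    ≡⟨ ℕ.+-comm 2 (i + 2) ⟩
    i + 2 + 2      ≡⟨ ℕ.+-assoc i 2 2 ⟩
    -- The order `i + 5 = 2k + 3` is odd, so the longest even cycle misses one vertex.
    i + 4          ≤⟨ ℕ.+-monoʳ-≤ i (ℕ.n≤1+n 4) ⟩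
    i + 5          ∎)

  Lₑ-H⁻ : ∀ {m} → Lₑ (H i) m → ∃[ j ] j < k × m ≡ (2 + j) * 2
  -- For `m = 2q`, `3 ≤ m` reads `1 * 2 < q * 2`, and `m ≤ 2k + 3 < 2 (2 + k)` bounds `q` from
  -- above.
  Lₑ-H⁻ (divides q refl , cyc) = index q (ℕ.*-cancelʳ-< 2 1 q (proj₁ cyc))
    (ℕ.*-cancelʳ-< 2 q (2 + k) (begin-strict
      q * 2          ≤⟨ join-K-C-cycle-≤ 3≤5 cyc ⟩
      i + 5          <⟨ ℕ.+-monoʳ-< i (ℕ.n<1+n 5) ⟩
      i + 6          ≡⟨ ℕ.+-assoc i 2 4 ⟨
      i + 2 + 4      ≡⟨ ℕ.+-comm (i + 2) 4 ⟩
      4 + (i + 2)    ≡⟨ cong (4 +_) i+2≡2k ⟩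
      4 + 2 * k      ≡⟨ cong (4 +_) (ℕ.*-comm 2 k) ⟩
      (2 + k) * 2    ∎))
    where
    index : ∀ q → 1 < q → q < 2 + k → ∃[ j ] j < k × q * 2 ≡ (2 + j) * 2
    index (suc zero)    (s≤s ())
    index (suc (suc j)) _ q<2+k = j , s≤s⁻¹ (s≤s⁻¹ q<2+k) , refl

  Lₑ-H-cardinality : HasCardinality (Lₑ (H i)) k
  Lₑ-H-cardinality = applyUpTo cycleLength k ,
    applyUpTo⁺₁ cycleLength k (λ j<j′ _ eq →
      ℕ.<⇒≢ j<j′ (ℕ.+-cancelˡ-≡ 2 _ _ (ℕ.*-cancelʳ-≡ _ _ 2 eq))) ,
    (λ m → mk⇔
      (λ m∈ → let j , j<k , m≡ = ∈-applyUpTo⁻ cycleLength m∈ in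
        subst (Lₑ (H i)) (sym m≡) (Lₑ-H⁺ j<k))
      (λ m∈L → let j , j<k , m≡ = Lₑ-H⁻ m∈L in
        subst (_∈ applyUpTo cycleLength k) (sym m≡) (∈-applyUpTo⁺ cycleLength j<k))) ,
    length-applyUpTo cycleLength k
    where
    cycleLength : ℕ → ℕ
    cycleLength j = (2 + j) * 2

  H-longestEvenCycleLength : 1 ≤ k → IsLongestEvenCycleLength (H i) (2 * k + 2)
  -- The last index `j = k - 1` gives the maximum, of the form `(1 + k) * 2`.
  H-longestEvenCycleLength (s≤s {n = k-1} _) = subst (IsMaximum (Lₑ (H i))) eq
    (Lₑ-H⁺ ℕ.≤-refl ,
     λ m m∈L → let j , j<k , m≡ = Lₑ-H⁻ m∈L in
       subst (_≤ (2 + k-1) * 2) (sym m≡) (ℕ.*-monoˡ-≤ 2 (s≤s j<k)))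
    where
    eq : (1 + k) * 2 ≡ 2 * k + 2
    eq = trans (cong (2 +_) (ℕ.*-comm k 2)) (ℕ.+-comm 2 (2 * k))

mainTheorem9 : (k : ℕ) → 2 ≤ k →
    ∃[ w ] ∃[ c ] ∃[ ℓ ] ∃[ χ ]
    (IsCliqueNumber (H (2 * k ∸ 2)) w
    × HasCardinality (Lₑ (H (2 * k ∸ 2))) c
    × IsLongestEvenCycleLength (H (2 * k ∸ 2)) ℓ
    × IsChromaticNumber (H (2 * k ∸ 2)) χ
    × w ≡ 2 * k
    × (2 * c + 2 ≡ ℓ × ℓ ≡ 2 * k + 2)
    × (χ ≡ 2 * k + 1 × 2 * k + 1 ≡ 2 * c + 1 × 2 * c + 1 ≡ ℓ ∸ 1)
    × (w ≡ 2 * c × χ ≡ 2 * c + 1))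
mainTheorem9 k 2≤k =
  2 * k , k , 2 * k + 2 , 2 * k + 1 ,
  subst (IsCliqueNumber (H r)) r+2≡2k (H-cliqueNumber r) ,
  Lₑ-H-cardinality 1≤r r+2≡2k ,
  H-longestEvenCycleLength 1≤r r+2≡2k (ℕ.<⇒≤ 2≤k) ,
  subst (IsChromaticNumber (H r)) r+3≡2k+1 (H-chromaticNumber r) ,
  refl , (refl , refl) , (refl , refl , sym (ℕ.+-∸-assoc (2 * k) (s≤s z≤n))) , (refl , refl)
  where
  r : ℕ
  r = 2 * k ∸ 2

  4≤2k : 4 ≤ 2 * k
  4≤2k = ℕ.*-monoʳ-≤ 2 2≤k

  -- Here `k ≥ 2` matters: for `k = 1` the graph would be `C₅` itself, which has no even cycle.
  1≤r : 1 ≤ r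
  1≤r = ℕ.<⇒≤ (ℕ.∸-monoˡ-≤ 2 4≤2k)

  r+2≡2k : r + 2 ≡ 2 * k
  r+2≡2k = ℕ.m∸n+n≡m (ℕ.≤-trans (s≤s (s≤s z≤n)) 4≤2k)

  r+3≡2k+1 : r + 3 ≡ 2 * k + 1
  r+3≡2k+1 = trans (sym (ℕ.+-assoc r 2 1)) (cong (_+ 1) r+2≡2k)
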